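{- Let $c\ge 2$ and $n\ge 1$ be integers. Write $n=cm+s$ with integers $m\ge 0$ and $s=n\bmod c\in\{0,\dots,c-1\}$, and set $r=s+1\in\{1,\dots,c\}$. Then the number of $c$-balanced Dyck paths of semilength $n$ is the Raney number $$R_{c+1,r}(m)=\frac{r}{(c+1)m+r}\binom{(c+1)m+r}{m}.$$
   Context: A Dyck path of semilength $n$ is a lattice path from $(0,0)$ to $(n,n)$ with unit east (E) steps $(1,0)$ and unit north (N) steps $(0,1)$ that never rises above the diagonal $y=x$. For $i\in\{1,\dots,n\}$, let $p_i$ be the number of cells in the $i$th column below the path $p$ (columns numbered $1,\dots,n$ from left to right), equivalently the number of N-steps taken before the $i$th E-step. Then $0=p_1\le p_2\le\cdots\le p_n$ and $p_i\le i-1$ for all $i$, and Dyck paths of semilength $n$ are in bijection with the integer vectors $(p_1,\dots,p_n)$ satisfying these conditions. Column $i$ is colored by its residue $i\bmod c$. The number of cells of color $j\in\mathbb{Z}/c\mathbb{Z}$ below $p$ is the class sum $S_j=\sum_{1\le i\le n,\ i\equiv j \pmod c} p_i$ (an empty sum is $0$). The path $p$ is called $c$-balanced if $S_0=S_1=\cdots=S_{c-1}$. -}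

module Defs where

open import Data.Fin.Base using (Fin; toℕ)
open import Data.Integer.Base using (+_)
open import Data.List.Base using (List; []; _∷_; filter; map)
open import Data.Nat.Base using (ℕ; suc; _+_; _*_; _%_; _≤_; NonZero; >-nonZero; >-nonZero⁻¹)
open import Data.Nat.Combinatorics using (_C_)
open import Data.Nat.ListAction using (sum)
open import Data.Nat.Properties using (_≟_; <-≤-trans; m≤n+m)
open import Data.Product.Base using (_×_; _,_; proj₁; proj₂)
open import Data.Rational.Base as ℚ using (ℚ)
open import Data.Refinement.Base using (Refinement)
open import Relation.Binary.PropositionalEquality.Core using (_≡_)

-- LatticePath a b x y : paths from (x , y) to (a , b).
data LatticePath (a b : ℕ) : ℕ → ℕ → Set where
  end   : LatticePath a b a b
  east  : ∀ {x y} → LatticePath a b (suc x) y → LatticePath a b x y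
  north : ∀ {x y} → LatticePath a b x (suc y) → LatticePath a b x y

-- Checking every lattice point visited is enough: a unit step between two
-- points on or below y = x does not leave that half-plane.
NeverAboveDiagonal : ∀ {a b x y} → LatticePath a b x y → Set
NeverAboveDiagonal {x = x} {y} end       = y ≤ x
NeverAboveDiagonal {x = x} {y} (east p)  = y ≤ x × NeverAboveDiagonal p
NeverAboveDiagonal {x = x} {y} (north p) = y ≤ x × NeverAboveDiagonal p

-- The pairs (i , pᵢ), with columns numbered from 1: an east step leaving
-- (x , y) crosses column x + 1, which has y cells below the path.
columns : ∀ {a b x y} → LatticePath a b x y → List (ℕ × ℕ)
columns end                  = []
columns (east {x = x} {y} p) = (suc x , y) ∷ columns p
columns (north p)            = columns p

-- The colors ℤ/cℤ are represented by the residues Fin c.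
classSum : ∀ {a b x y} (c : ℕ) .{{_ : NonZero c}} → Fin c → LatticePath a b x y → ℕ
classSum c j p =
  sum (map proj₂ (filter (λ col → proj₁ col % c ≟ toℕ j) (columns p)))

Balanced : ∀ {a b x y} (c : ℕ) .{{_ : NonZero c}} → LatticePath a b x y → Set
Balanced c p = ∀ (j k : Fin c) → classSum c j p ≡ classSum c k p

-- A refinement type, so that elements are equal as soon as the underlying
-- paths are, and counting elements counts paths.
BalancedDyckPath : (c : ℕ) .{{_ : NonZero c}} → ℕ → Set
BalancedDyckPath c n =
  Refinement (LatticePath n n 0 0) (λ p → NeverAboveDiagonal p × Balanced c p)

fromℕ : ℕ → ℚ
fromℕ k = + k ℚ./ 1

raney : (p r : ℕ) .{{_ : NonZero r}} → ℕ → ℚ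
raney p r k = (+ r ℚ./ (p * k + r)) ℚ.* fromℕ ((p * k + r) C k)
  where
  instance
    denominator≢0 : NonZero (p * k + r)
    denominator≢0 = >-nonZero (<-≤-trans (>-nonZero⁻¹ r) (m≤n+m r (p * k)))

{-# OPTIONS --safe #-}
-- Let S_t be the class sum of residue t.  Summation by parts compares adjacent
-- classes: for a path from (0 , 0) to (n , n),
--   S_t + #{north steps at abscissa ≡ t} = S_{t+1} + n [n ≡ t]   (mod c).
-- Taking t = n, equal class sums force all n north steps to abscissas ≡ n;
-- conversely, if all of them are there, the identity gives S_t = S_{t+1} for
-- every t.  Balanced paths are thus the Dyck paths made of s east steps followed
-- by blocks of c east steps, with north steps only between blocks.  With k blocks
-- left and slack d = x - y these are counted by a ballot-type recurrence, solved
-- by  C(N , k) - c C(N , k - 1)  where  N = (c + 1) k + d.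
module Submission where

open import Defs
open import Data.Bool.Base using (true; false; if_then_else_)
open import Data.Bool.Properties using (if-cong)
open import Data.Fin.Base using (Fin; toℕ; fromℕ<)
open import Data.Fin.Properties using (toℕ<n; toℕ-fromℕ<; +↔⊎; 1↔⊤)
open import Data.Integer.Base as ℤ using ()
import Data.Integer.Properties as ℤ
open import Data.Irrelevant using ([_])
open import Data.Nat.Base using (ℕ; zero; suc; pred; _+_; _*_; _%_; _≤_; _<_; _≡ᵇ_; NonZero; >-nonZero; z≤n; s≤s; z<s)
open import Data.Nat.Combinatorics using (_C_; nCk+nC[k+1]≡[n+1]C[k+1]; k>n⇒nCk≡0; nC1≡n)
open import Data.Nat.DivMod using (%-distribˡ-+; %-congˡ; [m+n]%n≡m%n; [m+kn]%n≡m%n; m%n<n; m%n%n≡m%n; m<n⇒m%n≡m)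
open import Data.Nat.Properties
open import Data.Nat.Tactic.RingSolver using (solve-∀)
open import Data.Product.Base using (_×_; ∃-syntax; _,_; proj₁; proj₂)
open import Data.Rational.Base as ℚ using (toℚᵘ; fromℚᵘ)
import Data.Rational.Properties as ℚ
open import Data.Rational.Unnormalised.Base as ℚᵘ using (mkℚᵘ; *≡*)
import Data.Rational.Unnormalised.Properties as ℚᵘ
open import Data.Refinement.Base using (Refinement; _,_; refine)
open import Data.Sum.Base using (_⊎_; inj₁; inj₂; [_,_]′)
open import Data.Sum.Function.Propositional using (_⊎-↔_)
open import Data.Unit.Base using (⊤; tt)
open import Function.Bundles using (_↔_; mk↔ₛ′; mk⇔)
open import Function.Properties.Inverse using (↔-sym; ↔-trans)
open import Relation.Binary.PropositionalEquality hiding ([_])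
open import Relation.Nullary.Decidable using (yes; no; does-⇔; dec-true; dec-false)
open import Relation.Nullary.Negation using (¬_; contradiction; contradiction-irr)

-- Residues and binomial identities.

%-cancel-suc : ∀ m n c .{{_ : NonZero c}} → suc m % c ≡ suc n % c → m % c ≡ n % c
%-cancel-suc m n c@(suc c′) eq = begin
  m % c                         ≡⟨ shift m ⟨
  (suc m % c + c′ % c) % c      ≡⟨ cong (λ z → (z + c′ % c) % c) eq ⟩
  (suc n % c + c′ % c) % c      ≡⟨ shift n ⟩
  n % c                         ∎
  where
  open ≡-Reasoning
  -- Adding `c′`, one less than the modulus, turns `suc l` into `l + c`, so the residue of `suc l`
  -- determines that of `l`.
  shift : ∀ l → (suc l % c + c′ % c) % c ≡ l % c
  shift l = begin
    (suc l % c + c′ % c) % c ≡⟨ %-distribˡ-+ (suc l) c′ c ⟨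
    (suc l + c′) % c         ≡⟨ %-congˡ {o = c} (sym (+-suc l c′)) ⟩
    (l + c) % c              ≡⟨ [m+n]%n≡m%n l c ⟩
    l % c                    ∎

%-suc : ∀ m n c .{{_ : NonZero c}} → m % c ≡ n % c → suc m % c ≡ suc n % c
%-suc m n c eq = begin
  suc m % c             ≡⟨ %-distribˡ-+ 1 m c ⟩
  (1 % c + m % c) % c   ≡⟨ cong (λ z → (1 % c + z) % c) eq ⟩
  (1 % c + n % c) % c   ≡⟨ %-distribˡ-+ 1 n c ⟨
  suc n % c             ∎
  where open ≡-Reasoning

%-cancelˡ-+ : ∀ k m n c .{{_ : NonZero c}} → (k + m) % c ≡ (k + n) % c → m % c ≡ n % c
%-cancelˡ-+ zero    m n c eq = eq
%-cancelˡ-+ (suc k) m n c eq = %-cancelˡ-+ k m n c (%-cancel-suc (k + m) (k + n) c eq)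

-- Pascal's rule and induction. No bound `k ≤ n` is imposed: both sides vanish when `k` exceeds `n`.
absorption : ∀ n k → suc k * (suc n C suc k) ≡ suc n * (n C k)
absorption zero    zero    = refl
absorption zero    (suc k) =
  trans (cong (suc (suc k) *_) (k>n⇒nCk≡0 {1} {suc (suc k)} (s≤s z<s))) (*-zeroʳ (suc (suc k)))
absorption (suc n) zero    = trans (*-identityˡ _) (trans (nC1≡n (suc (suc n))) (sym (*-identityʳ _)))
absorption (suc n) (suc k) = begin
  suc (suc k) * (suc (suc n) C suc (suc k))
    ≡⟨ cong (suc (suc k) *_) (nCk+nC[k+1]≡[n+1]C[k+1] (suc n) (suc k)) ⟨
  suc (suc k) * ((suc n C suc k) + (suc n C suc (suc k)))
    ≡⟨ split (suc k) (suc n C suc k) (suc n C suc (suc k)) ⟩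
  (suc n C suc k) + (suc k * (suc n C suc k) + suc (suc k) * (suc n C suc (suc k)))
    ≡⟨ cong (suc n C suc k +_) (cong₂ _+_ (absorption n k) (absorption n (suc k))) ⟩
  (suc n C suc k) + (suc n * (n C k) + suc n * (n C suc k))
    ≡⟨ cong (suc n C suc k +_) (*-distribˡ-+ (suc n) (n C k) (n C suc k)) ⟨
  (suc n C suc k) + suc n * ((n C k) + (n C suc k))
    ≡⟨ cong (λ z → (suc n C suc k) + suc n * z) (nCk+nC[k+1]≡[n+1]C[k+1] n k) ⟩
  suc (suc n) * (suc n C suc k) ∎
  where
  open ≡-Reasoning
  split : ∀ k u v → suc k * (u + v) ≡ u + (k * u + suc k * v)
  split = solve-∀

-- Color sums, north steps and alignment.

module _ (c : ℕ) .{{_ : NonZero c}} where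

  -- The Iverson bracket of congruence modulo `c`. A decision by `_≟_` computes to the Boolean
  -- `_≡ᵇ_`, so lemmas on decisions apply and the `filter` in `classSum` branches on the same test.
  ⟦_∼_⟧ : ℕ → ℕ → ℕ
  ⟦ x ∼ t ⟧ = if x % c ≡ᵇ t % c then 1 else 0

  ⟦∼⟧-suc : ∀ x t → ⟦ suc x ∼ suc t ⟧ ≡ ⟦ x ∼ t ⟧
  ⟦∼⟧-suc x t = if-cong (does-⇔ (mk⇔ (%-cancel-suc x t c) (%-suc x t c))
                                (suc x % c ≟ suc t % c) (x % c ≟ t % c))

  ⟦∼⟧≤1 : ∀ x t → ⟦ x ∼ t ⟧ ≤ 1
  ⟦∼⟧≤1 x t with x % c ≡ᵇ t % c
  ... | true  = ≤-refl
  ... | false = z≤n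

  ⟦∼⟧-refl : ∀ x → ⟦ x ∼ x ⟧ ≡ 1
  ⟦∼⟧-refl x = if-cong (dec-true (x % c ≟ x % c) refl)

  ⟦∼⟧-positive : ∀ x t → 0 < ⟦ x ∼ t ⟧ → x % c ≡ t % c
  ⟦∼⟧-positive x t pos with x % c ≟ t % c
  ... | yes eq = eq
  ... | no  ne = contradiction (subst (0 <_) (if-cong (dec-false (x % c ≟ t % c) ne)) pos) λ ()

  ⟦∼⟧-congˡ : ∀ x x′ t → x % c ≡ x′ % c → ⟦ x ∼ t ⟧ ≡ ⟦ x′ ∼ t ⟧
  ⟦∼⟧-congˡ x x′ t eq = cong (λ z → if z ≡ᵇ t % c then 1 else 0) eq

  -- A recursive form of `classSum` whose color is any natural number, so that passing from `t` to
  -- `suc t` needs no wraparound in `Fin c`.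
  colorSum : ∀ {a b x y} → ℕ → LatticePath a b x y → ℕ
  colorSum t end                  = 0
  colorSum t (east {x = x} {y} p) = ⟦ suc x ∼ t ⟧ * y + colorSum t p
  colorSum t (north p)            = colorSum t p

  classSum≡colorSum : ∀ {a b x y} (j : Fin c) (p : LatticePath a b x y) →
                      classSum c j p ≡ colorSum (toℕ j) p
  classSum≡colorSum j end                  = refl
  classSum≡colorSum j (north p)            = classSum≡colorSum j p
  classSum≡colorSum j (east {x = x} {y} p)
    -- `toℕ j` is its own residue, so both sides test the same Boolean.
    rewrite m<n⇒m%n≡m (toℕ<n j)
    with suc x % c ≡ᵇ toℕ j
  ... | true  = cong₂ _+_ (sym (+-identityʳ y)) (classSum≡colorSum j p)
  ... | false = classSum≡colorSum j p

  norths : ∀ {a b x y} → ℕ → LatticePath a b x y → ℕ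
  norths t end               = 0
  norths t (east p)          = norths t p
  norths t (north {x = x} p) = ⟦ x ∼ t ⟧ + norths t p

  -- The term `y * ⟦ x ∼ t ⟧` is the boundary term at the starting point, which lets the induction
  -- run along the path. An east step trades it for the cells of column `suc x` in color `suc t`,
  -- while the cells in color `t` become the new boundary term. A north step moves one bracket from
  -- `norths` into it.
  summation-by-parts : ∀ {a b x y} t (p : LatticePath a b x y) →
    colorSum t p + (y * ⟦ x ∼ t ⟧ + norths t p) ≡ colorSum (suc t) p + b * ⟦ a ∼ t ⟧
  summation-by-parts t end = +-identityʳ _
  summation-by-parts {a} {b} t (east {x = x} {y} p) = begin
    (⟦ suc x ∼ t ⟧ * y + colorSum t p) + (y * ⟦ x ∼ t ⟧ + norths t p)
      ≡⟨ regroup ⟦ suc x ∼ t ⟧ y (colorSum t p) ⟦ x ∼ t ⟧ (norths t p) ⟩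
    ⟦ x ∼ t ⟧ * y + (colorSum t p + (y * ⟦ suc x ∼ t ⟧ + norths t p))
      ≡⟨ cong₂ _+_ (cong (_* y) (sym (⟦∼⟧-suc x t))) (summation-by-parts t p) ⟩
    ⟦ suc x ∼ suc t ⟧ * y + (colorSum (suc t) p + b * ⟦ a ∼ t ⟧)
      ≡⟨ +-assoc (⟦ suc x ∼ suc t ⟧ * y) _ _ ⟨
    (⟦ suc x ∼ suc t ⟧ * y + colorSum (suc t) p) + b * ⟦ a ∼ t ⟧ ∎
    where
    open ≡-Reasoning
    regroup : ∀ u y s v n → (u * y + s) + (y * v + n) ≡ v * y + (s + (y * u + n))
    regroup = solve-∀
  summation-by-parts {a} {b} t (north {x = x} {y} p) =
    trans (regroup (colorSum t p) y ⟦ x ∼ t ⟧ (norths t p)) (summation-by-parts t p)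
    where
    regroup : ∀ s y v n → s + (y * v + (v + n)) ≡ s + (suc y * v + n)
    regroup = solve-∀

  -- The residue is that of the final abscissa `a`, the one singled out by the right-hand boundary
  -- term of `summation-by-parts`.
  Aligned : ∀ {a b x y} → LatticePath a b x y → Set
  Aligned         end               = ⊤
  Aligned         (east p)          = Aligned p
  Aligned {a = a} (north {x = x} p) = x % c ≡ a % c × Aligned p

  -- Exactly `b - y` north steps remain, and alignment gives each of them the bracket of `a`.
  aligned⇒norths : ∀ {a b x y} t (p : LatticePath a b x y) → Aligned p →
                   y * ⟦ a ∼ t ⟧ + norths t p ≡ b * ⟦ a ∼ t ⟧
  aligned⇒norths t end      _  = +-identityʳ _
  aligned⇒norths t (east p) al = aligned⇒norths t p al
  aligned⇒norths {a} {b} t (north {x = x} {y} p) (eq , al) = begin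
    y * ⟦ a ∼ t ⟧ + (⟦ x ∼ t ⟧ + norths t p)
      ≡⟨ cong (λ z → y * ⟦ a ∼ t ⟧ + (z + norths t p)) (⟦∼⟧-congˡ x a t eq) ⟩
    y * ⟦ a ∼ t ⟧ + (⟦ a ∼ t ⟧ + norths t p)
      ≡⟨ regroup y ⟦ a ∼ t ⟧ (norths t p) ⟩
    suc y * ⟦ a ∼ t ⟧ + norths t p
      ≡⟨ aligned⇒norths t p al ⟩
    b * ⟦ a ∼ t ⟧ ∎
    where
    open ≡-Reasoning
    regroup : ∀ y v n → y * v + (v + n) ≡ suc y * v + n
    regroup = solve-∀

  norths-bound : ∀ {a b x y} t (p : LatticePath a b x y) → y + norths t p ≤ b
  norths-bound t end                       = ≤-reflexive (+-identityʳ _)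
  norths-bound t (east p)                  = norths-bound t p
  norths-bound {b = b} t (north {x = x} {y} p) = begin
    y + (⟦ x ∼ t ⟧ + norths t p) ≤⟨ +-monoʳ-≤ y (+-monoˡ-≤ (norths t p) (⟦∼⟧≤1 x t)) ⟩
    y + suc (norths t p)         ≡⟨ +-suc y (norths t p) ⟩
    suc y + norths t p           ≤⟨ norths-bound t p ⟩
    b                            ∎
    where open ≤-Reasoning

  -- The equality case of `norths-bound`: `b - y` brackets, each at most 1, can sum to `b - y` only
  -- if every one is 1.
  saturated⇒aligned : ∀ {a b x y} (p : LatticePath a b x y) →
                      y + norths a p ≡ b → Aligned p
  saturated⇒aligned end      _  = tt
  saturated⇒aligned (east p) eq = saturated⇒aligned p eq
  saturated⇒aligned {a} {b} (north {x = x} {y} p) eq =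
    ⟦∼⟧-positive x a positive , saturated⇒aligned p (trans (sym step) eq)
    where
    positive : 0 < ⟦ x ∼ a ⟧
    positive = +-cancelʳ-≤ (norths a p) 1 ⟦ x ∼ a ⟧ (+-cancelˡ-≤ y _ _ (begin
      y + suc (norths a p)         ≡⟨ +-suc y (norths a p) ⟩
      suc y + norths a p           ≤⟨ norths-bound a p ⟩
      b                            ≡⟨ eq ⟨
      y + (⟦ x ∼ a ⟧ + norths a p) ∎))
      where open ≤-Reasoning
    step : y + (⟦ x ∼ a ⟧ + norths a p) ≡ suc y + norths a p
    step = trans (cong (λ z → y + (z + norths a p)) (≤-antisym (⟦∼⟧≤1 x a) positive))
                 (+-suc y (norths a p))

  colorSum-% : ∀ {a b x y} t (p : LatticePath a b x y) → colorSum (t % c) p ≡ colorSum t p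
  colorSum-% t end                      = refl
  colorSum-% t (east {x = x} {y = y} p) =
    cong₂ (λ z w → (if suc x % c ≡ᵇ z then 1 else 0) * y + w) (m%n%n≡m%n t c) (colorSum-% t p)
  colorSum-% t (north p)                = colorSum-% t p

  balanced⇒colorSum : ∀ {a b x y} {p : LatticePath a b x y} → Balanced c p →
                      ∀ t u → colorSum t p ≡ colorSum u p
  balanced⇒colorSum {p = p} bal t u = begin
    colorSum t p                     ≡⟨ toClass t ⟩
    classSum c (fromℕ< (m%n<n t c)) p ≡⟨ bal _ _ ⟩
    classSum c (fromℕ< (m%n<n u c)) p ≡⟨ toClass u ⟨
    colorSum u p                     ∎
    where
    open ≡-Reasoning
    toClass : ∀ t → colorSum t p ≡ classSum c (fromℕ< (m%n<n t c)) p
    toClass t = begin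
      colorSum t p                              ≡⟨ colorSum-% t p ⟨
      colorSum (t % c) p                        ≡⟨ cong (λ z → colorSum z p) (toℕ-fromℕ< (m%n<n t c)) ⟨
      colorSum (toℕ (fromℕ< (m%n<n t c))) p     ≡⟨ classSum≡colorSum _ p ⟨
      classSum c (fromℕ< (m%n<n t c)) p         ∎

  -- At height 0 the starting boundary term computes to 0, so cancelling equal color sums leaves
  -- `norths a p ≡ b`.
  balanced⇒aligned : ∀ {a b x} (p : LatticePath a b x 0) → Balanced c p → Aligned p
  balanced⇒aligned {a} {b} p bal = saturated⇒aligned p (+-cancelˡ-≡ (colorSum a p) _ _ (begin
    colorSum a p + norths a p             ≡⟨ summation-by-parts a p ⟩
    colorSum (suc a) p + b * ⟦ a ∼ a ⟧    ≡⟨ cong₂ (λ z w → z + b * w)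
                                               (balanced⇒colorSum {p = p} bal (suc a) a) (⟦∼⟧-refl a) ⟩
    colorSum a p + b * 1                  ≡⟨ cong (colorSum a p +_) (*-identityʳ b) ⟩
    colorSum a p + b                      ∎))
    where open ≡-Reasoning

  aligned⇒balanced : ∀ {a b x} (p : LatticePath a b x 0) → Aligned p → Balanced c p
  aligned⇒balanced {a} {b} p al j k = begin
    classSum c j p        ≡⟨ classSum≡colorSum j p ⟩
    colorSum (toℕ j) p    ≡⟨ constant (toℕ j) ⟩
    colorSum 0 p          ≡⟨ constant (toℕ k) ⟨
    colorSum (toℕ k) p    ≡⟨ classSum≡colorSum k p ⟨
    classSum c k p        ∎
    where
    open ≡-Reasoning
    constant : ∀ t → colorSum t p ≡ colorSum 0 p
    constant zero    = refl
    constant (suc t) = trans (+-cancelʳ-≡ (b * ⟦ a ∼ t ⟧) _ _ (begin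
      colorSum (suc t) p + b * ⟦ a ∼ t ⟧  ≡⟨ summation-by-parts t p ⟨
      colorSum t p + norths t p           ≡⟨ cong (colorSum t p +_) (aligned⇒norths t p al) ⟩
      colorSum t p + b * ⟦ a ∼ t ⟧        ∎)) (constant t)

  -- Aligned Dyck paths, split by their first step.

  AlignedDyckPath : ℕ → ℕ → ℕ → Set
  AlignedDyckPath n x y =
    Refinement (LatticePath n n x y) (λ p → NeverAboveDiagonal p × Aligned p)

  -- The underlying path is unchanged and the refining proofs are irrelevant, so both round trips
  -- are `refl`.
  balanced↔aligned : ∀ n → BalancedDyckPath c n ↔ AlignedDyckPath n 0 0
  balanced↔aligned n = mk↔ₛ′
    (refine λ { {p} (dy , bal) → dy , balanced⇒aligned p bal })
    (refine λ { {p} (dy , al) → dy , aligned⇒balanced p al })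
    (λ _ → refl) (λ _ → refl)

  start-below : ∀ {a b x y} (p : LatticePath a b x y) → NeverAboveDiagonal p → y ≤ x
  start-below end       y≤x       = y≤x
  start-below (east p)  (y≤x , _) = y≤x
  start-below (north p) (y≤x , _) = y≤x

  start-left : ∀ {a b x y} → LatticePath a b x y → x ≤ a
  start-left end       = ≤-refl
  start-left (east p)  = <⇒≤ (start-left p)
  start-left (north p) = start-left p

  module _ {n x y : ℕ} where

    consEast : y ≤ x → AlignedDyckPath n (suc x) y → AlignedDyckPath n x y
    consEast y≤x (p , [ g ]) = east p , [ (y≤x , proj₁ g) , proj₂ g ]

    consNorth : y ≤ x → x % c ≡ n % c → AlignedDyckPath n x (suc y) → AlignedDyckPath n x y
    consNorth y≤x eq (p , [ g ]) = north p , [ (y≤x , proj₁ g) , (eq , proj₂ g) ]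

    -- `x < n` excludes `end`. A leading north step would give `y < x`, from the point it reaches,
    -- together with the congruence; both come from irrelevant data, hence `contradiction-irr`.
    onlyEast : y ≤ x → x < n → ¬ (y < x × x % c ≡ n % c) →
               AlignedDyckPath n x y ↔ AlignedDyckPath n (suc x) y
    onlyEast y≤x x<n ¬north = mk↔ₛ′ uncons (consEast y≤x) (λ _ → refl) inverse
      where
      uncons : AlignedDyckPath n x y → AlignedDyckPath n (suc x) y
      uncons (end     , _)     = contradiction x<n (<-irrefl refl)
      uncons (east p  , [ g ]) = p , [ proj₂ (proj₁ g) , proj₂ g ]
      uncons (north p , [ g ]) =
        contradiction-irr (start-below p (proj₂ (proj₁ g)) , proj₁ (proj₂ g)) ¬north
      inverse : ∀ q → consEast y≤x (uncons q) ≡ q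
      inverse (end     , _)     = contradiction x<n (<-irrefl refl)
      inverse (east p  , _)     = refl
      inverse (north p , [ g ]) =
        contradiction-irr (start-below p (proj₂ (proj₁ g)) , proj₁ (proj₂ g)) ¬north

    eastOrNorth : y ≤ x → x < n → x % c ≡ n % c →
                  AlignedDyckPath n x y ↔ (AlignedDyckPath n (suc x) y ⊎ AlignedDyckPath n x (suc y))
    eastOrNorth y≤x x<n eq = mk↔ₛ′ uncons cons inverseˡ inverseʳ
      where
      cons : AlignedDyckPath n (suc x) y ⊎ AlignedDyckPath n x (suc y) → AlignedDyckPath n x y
      cons = [ consEast y≤x , consNorth y≤x eq ]′
      uncons : AlignedDyckPath n x y → AlignedDyckPath n (suc x) y ⊎ AlignedDyckPath n x (suc y)
      uncons (end     , _)     = contradiction x<n (<-irrefl refl)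
      uncons (east p  , [ g ]) = inj₁ (p , [ proj₂ (proj₁ g) , proj₂ g ])
      uncons (north p , [ g ]) = inj₂ (p , [ proj₂ (proj₁ g) , proj₂ (proj₂ g) ])
      inverseˡ : ∀ q → uncons (cons q) ≡ q
      inverseˡ (inj₁ _) = refl
      inverseˡ (inj₂ _) = refl
      inverseʳ : ∀ q → cons (uncons q) ≡ q
      inverseʳ (end     , _) = contradiction x<n (<-irrefl refl)
      inverseʳ (east p  , _) = refl
      inverseʳ (north p , _) = refl

  onlyNorth : ∀ {n x y} → x ≡ n → y < x → AlignedDyckPath n x y ↔ AlignedDyckPath n x (suc y)
  onlyNorth {n} {y = y} refl y<n = mk↔ₛ′ uncons cons (λ _ → refl) inverse
    where
    cons : AlignedDyckPath n n (suc y) → AlignedDyckPath n n y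
    cons = consNorth (<⇒≤ y<n) refl
    uncons : AlignedDyckPath n n y → AlignedDyckPath n n (suc y)
    uncons (end     , _)     = contradiction y<n (<-irrefl refl)
    uncons (east p  , _)     = contradiction (start-left p) (<-irrefl refl)
    uncons (north p , [ g ]) = p , [ proj₂ (proj₁ g) , proj₂ (proj₂ g) ]
    inverse : ∀ q → cons (uncons q) ≡ q
    inverse (end     , _) = contradiction y<n (<-irrefl refl)
    inverse (east p  , _) = contradiction (start-left p) (<-irrefl refl)
    inverse (north p , _) = refl

  onlyEnd : ∀ {n} → AlignedDyckPath n n n ↔ ⊤
  onlyEnd {n} = mk↔ₛ′ (λ _ → tt) (λ _ → stop) (λ _ → refl) unique
    where
    stop : AlignedDyckPath n n n
    stop = end , [ ≤-refl , tt ]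
    unique : ∀ q → stop ≡ q
    unique (end     , _)     = refl
    unique (east p  , _)     = contradiction (start-left p) (<-irrefl refl)
    unique (north p , [ g ]) =
      contradiction-irr (start-below p (proj₂ (proj₁ g))) (<-irrefl refl)

  -- The ballot recurrence and the bijection with it.

  ballot : ℕ → ℕ → ℕ
  ballot zero    d       = 1
  ballot (suc k) zero    = ballot k c
  -- Either a block of east steps, adding `c` to the slack, or a north step, lowering it by one. At
  -- slack zero only the block is possible.
  ballot (suc k) (suc d) = ballot k (c + suc d) + ballot (suc k) d

  block-step : ∀ {n} x k → x + suc k * c ≡ n → suc x + (pred c + k * c) ≡ n
  block-step x k eq =
    trans (sym (+-suc x _)) (trans (cong (λ z → x + (z + k * c)) (suc-pred c)) eq)

  block⇒< : ∀ {n} x k → x + suc k * c ≡ n → x < n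
  block⇒< x k eq = ≤-trans (m≤m+n (suc x) _) (≤-reflexive (block-step x k eq))

  -- At (x , y), i is the number of east steps to the next abscissa ≡ n and k is
  -- the number of blocks of c east steps after that.
  count : ∀ {n x y} k i d → x + (i + k * c) ≡ n → x ≡ d + y → i < c →
          AlignedDyckPath n x y ↔ Fin (ballot k (i + d))
  -- Here the first east step of a block has been taken. The other `pred c` are forced, and the
  -- block ends with slack `c + d`.
  count-block : ∀ {n x y} k d → x + suc k * c ≡ n → x ≡ d + y →
                AlignedDyckPath n (suc x) y ↔ Fin (ballot k (c + d))

  -- Strictly inside a block the east step is forced. It preserves `i + d`, the slack on arrival at
  -- the next aligned abscissa.
  count {n} {x} {y} k (suc i) d eq refl i<c =
    subst (λ z → AlignedDyckPath n x y ↔ Fin (ballot k z)) (+-suc i d)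
      (↔-trans (onlyEast (m≤n+m y d) x<n λ (_ , aligned) → ¬aligned aligned)
               (count k i (suc d) eq′ refl (<-trans (n<1+n i) i<c)))
    where
    eq′ : suc x + (i + k * c) ≡ n
    eq′ = trans (sym (+-suc x _)) eq
    x<n : x < n
    x<n = ≤-trans (m≤m+n (suc x) _) (≤-reflexive eq′)
    -- The distance left to `n` has residue `suc i`, nonzero because `suc i < c`.
    ¬aligned : ¬ (x % c ≡ n % c)
    ¬aligned e = contradiction (begin
      0                       ≡⟨ m<n⇒m%n≡m (≤-trans z<s i<c) ⟨
      0 % c                   ≡⟨ %-cancelˡ-+ x 0 (suc i + k * c) c
                                   (trans (%-congˡ {o = c} (+-identityʳ x))
                                          (trans e (%-congˡ {o = c} (sym eq)))) ⟩
      (suc i + k * c) % c     ≡⟨ [m+kn]%n≡m%n (suc i) k c ⟩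
      suc i % c               ≡⟨ m<n⇒m%n≡m i<c ⟩
      suc i                   ∎) λ ()
      where open ≡-Reasoning
  count {n} {x} zero zero zero eq refl _ rewrite trans (sym (+-identityʳ x)) eq =
    ↔-trans onlyEnd (↔-sym 1↔⊤)
  count {n} {x} {y} zero zero (suc d) eq refl 0<c =
    ↔-trans (onlyNorth (trans (sym (+-identityʳ x)) eq) (m<n+m y z<s))
            (count zero zero d eq (sym (+-suc d y)) 0<c)
  count {n} {x} (suc k) zero zero eq refl _ =
    subst (λ z → AlignedDyckPath n x x ↔ Fin (ballot k z)) (+-identityʳ c)
      (↔-trans (onlyEast ≤-refl (block⇒< x k eq) λ (y<y , _) → <-irrefl refl y<y)
               (count-block k 0 eq refl))
  -- The only genuine choice: the disjoint union becomes the sum in `ballot`.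
  count {n} {x} {y} (suc k) zero (suc d) eq refl 0<c =
    ↔-trans (eastOrNorth (m≤n+m y (suc d)) (block⇒< x k eq) aligned)
      (↔-trans (count-block k (suc d) eq refl ⊎-↔ count (suc k) zero d eq (sym (+-suc d y)) 0<c)
               (↔-sym +↔⊎))
    where
    aligned : x % c ≡ n % c
    aligned = trans (sym ([m+kn]%n≡m%n x (suc k) c)) (%-congˡ {o = c} eq)

  count-block {n} {x} {y} k d eq x≡d+y =
    subst (λ z → AlignedDyckPath n (suc x) y ↔ Fin (ballot k z))
      (trans (+-suc (pred c) d) (cong (_+ d) (suc-pred c)))
      (count k (pred c) (suc d) (block-step x k eq) (cong suc x≡d+y) (≤-reflexive (suc-pred c)))

  -- Closed form and Raney numbers in product form.

  ballot-one : ∀ d → ballot 1 d ≡ suc d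
  ballot-one zero    = refl
  ballot-one (suc d) = cong suc (ballot-one d)

  -- Stated additively to avoid subtraction, and for `suc k` so that the lower index of the second
  -- binomial makes sense. At positive slack both terms of the recurrence have upper index `N - 1`,
  -- so Pascal's rule adds them up; at slack zero absorption is needed.
  ballot-closed : ∀ k d → let N = suc c * suc k + d in
                  ballot (suc k) d + c * (N C k) ≡ N C suc k
  ballot-closed zero d = begin
    ballot 1 d + c * 1     ≡⟨ cong (_+ c * 1) (ballot-one d) ⟩
    suc d + c * 1          ≡⟨ regroup c d ⟩
    suc c * 1 + d          ≡⟨ nC1≡n (suc c * 1 + d) ⟨
    (suc c * 1 + d) C 1    ∎
    where
    open ≡-Reasoning
    regroup : ∀ c d → suc d + c * 1 ≡ suc c * 1 + d
    regroup = solve-∀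
  ballot-closed (suc k) zero = begin
    ballot (suc k) c + c * (N C suc k)
      ≡⟨ cong (λ z → ballot (suc k) c + c * (z C suc k)) N≡1+M ⟩
    ballot (suc k) c + c * (suc M C suc k)
      ≡⟨ cong (λ z → ballot (suc k) c + c * z) (nCk+nC[k+1]≡[n+1]C[k+1] M k) ⟨
    ballot (suc k) c + c * ((M C k) + (M C suc k))
      ≡⟨ regroup (ballot (suc k) c) c (M C k) (M C suc k) ⟩
    (ballot (suc k) c + c * (M C k)) + c * (M C suc k)
      ≡⟨ cong (_+ c * (M C suc k)) (ballot-closed k c) ⟩
    suc c * (M C suc k)
      ≡⟨ *-cancelˡ-≡ _ _ (suc (suc k)) top ⟨
    suc M C suc (suc k)
      ≡⟨ cong (_C suc (suc k)) N≡1+M ⟨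
    N C suc (suc k) ∎
    where
    open ≡-Reasoning
    M N : ℕ
    M = suc c * suc k + c
    N = suc c * suc (suc k) + 0
    size : ∀ c k → suc c * suc (suc k) + 0 ≡ suc (suc c * suc k + c)
    size = solve-∀
    N≡1+M : N ≡ suc M
    N≡1+M = size c k
    regroup : ∀ f c u v → f + c * (u + v) ≡ (f + c * u) + c * v
    regroup = solve-∀
    factor : ∀ c k u → suc (suc c * suc k + c) * u ≡ suc (suc k) * (suc c * u)
    factor = solve-∀
    -- At slack zero `suc M` equals `suc c * suc (suc k)`, so absorption yields the factor `suc c`
    -- once `suc (suc k)` is cancelled.
    top : suc (suc k) * (suc M C suc (suc k)) ≡ suc (suc k) * (suc c * (M C suc k))
    top = trans (absorption M (suc k)) (factor c k (M C suc k))
  ballot-closed (suc k) (suc d) = begin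
    ballot (suc k) (c + suc d) + ballot (suc (suc k)) d + c * (N C suc k)
      ≡⟨ cong (λ z → f + g + c * (z C suc k)) N≡1+M ⟩
    f + g + c * (suc M C suc k)
      ≡⟨ cong (λ z → f + g + c * z) (nCk+nC[k+1]≡[n+1]C[k+1] M k) ⟨
    f + g + c * ((M C k) + (M C suc k))
      ≡⟨ regroup f g c (M C k) (M C suc k) ⟩
    (f + c * (M C k)) + (g + c * (M C suc k))
      ≡⟨ cong₂ _+_ fClosed (ballot-closed (suc k) d) ⟩
    (M C suc k) + (M C suc (suc k))
      ≡⟨ nCk+nC[k+1]≡[n+1]C[k+1] M (suc k) ⟩
    suc M C suc (suc k)
      ≡⟨ cong (_C suc (suc k)) N≡1+M ⟨
    N C suc (suc k) ∎
    where
    open ≡-Reasoning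
    M N f g : ℕ
    M = suc c * suc (suc k) + d
    N = suc c * suc (suc k) + suc d
    f = ballot (suc k) (c + suc d)
    g = ballot (suc (suc k)) d
    N≡1+M : N ≡ suc M
    N≡1+M = +-suc (suc c * suc (suc k)) d
    size : ∀ c k d → suc c * suc k + (c + suc d) ≡ suc c * suc (suc k) + d
    size = solve-∀
    fClosed : f + c * (M C k) ≡ M C suc k
    fClosed = subst (λ z → f + c * (z C k) ≡ z C suc k) (size c k d) (ballot-closed k (c + suc d))
    regroup : ∀ f g c u v → f + g + c * (u + v) ≡ (f + c * u) + (g + c * v)
    regroup = solve-∀

  -- The Raney fraction with `r = suc d`, cross-multiplied. For positive `k`, absorption rewrites
  -- the closed form as a multiple of a single binomial.
  ballot-raney : ∀ k d → let N = suc c * k + suc d in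
                 ballot k d * N ≡ suc d * (N C k)
  ballot-raney zero d = regroup c d
    where
    regroup : ∀ c d → 1 * (suc c * 0 + suc d) ≡ suc d * 1
    regroup = solve-∀
  ballot-raney (suc k) d = subst (λ z → f * z ≡ suc d * (z C suc k)) (sym (+-suc (suc c * suc k) d))
    (*-cancelˡ-≡ _ _ (suc k) (begin
      suc k * (f * suc N)                   ≡⟨ *-assoc (suc k) f (suc N) ⟨
      (suc k * f) * suc N                   ≡⟨ cong (_* suc N) f≡ ⟩
      (suc d * (N C k)) * suc N             ≡⟨ regroup (suc d) (N C k) (suc N) ⟩
      suc d * (suc N * (N C k))             ≡⟨ cong (suc d *_) (absorption N k) ⟨
      suc d * (suc k * (suc N C suc k))     ≡⟨ swap (suc d) (suc k) (suc N C suc k) ⟩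
      suc k * (suc d * (suc N C suc k))     ∎))
    where
    open ≡-Reasoning
    -- This `N` is the one of `ballot-closed`, one less than the denominator in the statement; hence
    -- the `suc N` above.
    N f : ℕ
    N = suc c * suc k + d
    f = ballot (suc k) d
    regroup : ∀ u v w → (u * v) * w ≡ u * (w * v)
    regroup = solve-∀
    swap : ∀ u v w → u * (v * w) ≡ v * (u * w)
    swap = solve-∀
    collect : ∀ c k f u → suc k * f + (suc c * suc k) * u ≡ suc k * (u + (f + c * u))
    collect = solve-∀
    spread : ∀ c k d u → suc (suc c * suc k + d) * u ≡ suc d * u + (suc c * suc k) * u
    spread = solve-∀
    f≡ : suc k * f ≡ suc d * (N C k)
    -- Adding the same multiple of `N C k` to both sides replaces a subtraction; each side then
    -- equals `suc k * (suc N C suc k)`.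
    f≡ = +-cancelʳ-≡ ((suc c * suc k) * (N C k)) _ _ (begin
      suc k * f + (suc c * suc k) * (N C k)        ≡⟨ collect c k f (N C k) ⟩
      suc k * ((N C k) + (f + c * (N C k)))        ≡⟨ cong (λ z → suc k * ((N C k) + z)) (ballot-closed k d) ⟩
      suc k * ((N C k) + (N C suc k))              ≡⟨ cong (suc k *_) (nCk+nC[k+1]≡[n+1]C[k+1] N k) ⟩
      suc k * (suc N C suc k)                      ≡⟨ absorption N k ⟩
      suc N * (N C k)                              ≡⟨ spread c k d (N C k) ⟩
      suc d * (N C k) + (suc c * suc k) * (N C k)  ∎)

-- Passage to rationals and conclusion.

fromℕ-fraction : ∀ N r D K .{{_ : NonZero D}} → N * D ≡ r * K →
                 fromℕ N ≡ (ℤ.+ r ℚ./ D) ℚ.* fromℕ K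
-- `ℚ./` reduces to lowest terms, so the comparison is made between unnormalised fractions, where
-- equality is cross-multiplication.
fromℕ-fraction N r (suc d) K eq = ℚ.toℚᵘ-injective (begin
  toℚᵘ (fromℕ N)                                ≈⟨ ℚ.toℚᵘ-fromℚᵘ N/1 ⟩
  N/1                                           ≈⟨ *≡* cross ⟩
  r/D ℚᵘ.* K/1                                  ≈⟨ ℚᵘ.*-cong (ℚ.toℚᵘ-fromℚᵘ r/D) (ℚ.toℚᵘ-fromℚᵘ K/1) ⟨
  toℚᵘ (fromℚᵘ r/D) ℚᵘ.* toℚᵘ (fromℕ K)         ≈⟨ ℚ.toℚᵘ-homo-* (fromℚᵘ r/D) (fromℕ K) ⟨
  toℚᵘ (fromℚᵘ r/D ℚ.* fromℕ K)                 ∎)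
  where
  open ℚᵘ.≃-Reasoning
  N/1 = mkℚᵘ (ℤ.+ N) 0
  K/1 = mkℚᵘ (ℤ.+ K) 0
  r/D = mkℚᵘ (ℤ.+ r) d
  cross : ℤ.+ N ℤ.* ℚᵘ.↧ (r/D ℚᵘ.* K/1) ≡ (ℤ.+ r ℤ.* ℤ.+ K) ℤ.* ℤ.+ 1
  cross = trans (cong (λ z → ℤ.+ N ℤ.* ℤ.+ z) (*-identityʳ (suc d)))
    (trans (sym (ℤ.pos-* N (suc d)))
    (trans (cong ℤ.+_ eq)
    (trans (ℤ.pos-* r K) (sym (ℤ.*-identityʳ _)))))

theorem1p3 : ∀ (c n : ℕ) .{{_ : NonZero c}} → 2 ≤ c → 1 ≤ n →
    ∀ (m s : ℕ) → n ≡ c * m + s → s ≡ n % c →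
    ∃[ N ] (BalancedDyckPath c n ↔ Fin N) × (fromℕ N ≡ raney (suc c) (suc s) m)
theorem1p3 c n _ _ m s n≡cm+s s≡n%c =
  -- From the origin, `s` forced east steps lead to the first abscissa congruent to `n`, with slack
  -- `s` and `m` blocks still to come.
  ballot c m s ,
  ↔-trans (balanced↔aligned c n)
    (subst (λ z → AlignedDyckPath c n 0 0 ↔ Fin (ballot c m z)) (+-identityʳ s)
      (count c m s 0 size refl (subst (_< c) (sym s≡n%c) (m%n<n n c)))) ,
  fromℕ-fraction (ballot c m s) (suc s) (suc c * m + suc s) _
    {{>-nonZero (<-≤-trans z<s (m≤n+m (suc s) (suc c * m)))}} (ballot-raney c m s)
  where
  size : s + m * c ≡ n
  size = trans (+-comm s (m * c)) (trans (cong (_+ s) (*-comm m c)) (sym n≡cm+s))
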